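{- Every two-solution ordinal algorithm for makespan minimization on $m=3$ identical machines has a competitive ratio of at least $\frac43$.
   Context: Ordinal makespan scheduling on $m$ identical machines. Jobs are indexed by positive integers. A realization is a sequence of real job sizes $p_1\ge p_2\ge p_3\ge\cdots\ge 0$ with only finitely many positive sizes. A solution is a partition of the set of all positive integers into $m$ sets $J_1,\dots,J_m$ (some may be empty), where $J_i$ is the set of jobs assigned to machine $i$; it is fixed without knowledge of the realization. For a realization, the load of machine $i$ in the solution is $\sum_{j\in J_i}p_j$, and the completion time of the solution is the maximum load of any machine. A two-solution ordinal algorithm consists of two solutions; its makespan for a realization is the minimum of the completion times of its two solutions for that realization. The optimal offline completion time $\lambda$ of a realization is the minimum completion time over all solutions (chosen with full knowledge of the realization). The competitive ratio of the algorithm is the supremum, over all realizations with $\lambda>0$, of the ratio between its makespan and $\lambda$. -}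

module Defs where

open import Data.Fin using (Fin)
open import Data.Fin.Properties using (_≟_)
open import Data.List using (List; allFin; filter; foldr; map; upTo)
open import Data.Nat as ℕ using (ℕ; suc)
import Data.Nat.Properties as ℕ
open import Data.Product using (Σ-syntax; ∃-syntax; _×_; _,_)
open import Data.Rational as ℚ using (ℚ; 0ℚ; 1ℚ; ½; ∣_∣)
import Data.Rational.Properties as ℚ
open import Data.Rational.Solver using (module +-*-Solver)
open import Data.Sum using (inj₁; inj₂)
open import Level using (0ℓ)
open import Relation.Binary.PropositionalEquality
  using (_≡_; refl; sym; trans; cong; subst)
open import Relation.Unary using (Pred)

-- The reals are the setoid of Cauchy sequences of rationals under _≈_.

Cauchy : (ℕ → ℚ) → Set
Cauchy x = ∀ ε → 0ℚ ℚ.< ε →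
  ∃[ N ] ∀ {m n} → N ℕ.≤ m → N ℕ.≤ n → ∣ x m ℚ.- x n ∣ ℚ.< ε

record ℝ : Set where
  constructor mkℝ
  field
    seq    : ℕ → ℚ
    cauchy : Cauchy seq

open ℝ public

infix 4 _≈_ _≤_ _<_

_≈_ : ℝ → ℝ → Set
x ≈ y = ∀ ε → 0ℚ ℚ.< ε →
  ∃[ N ] ∀ {n} → N ℕ.≤ n → ∣ seq x n ℚ.- seq y n ∣ ℚ.< ε

_≤_ : ℝ → ℝ → Set
x ≤ y = ∀ ε → 0ℚ ℚ.< ε →
  ∃[ N ] ∀ {n} → N ℕ.≤ n → seq x n ℚ.< seq y n ℚ.+ ε

_<_ : ℝ → ℝ → Set
x < y = ∃[ ε ] 0ℚ ℚ.< ε ×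
  ∃[ N ] (∀ {n} → N ℕ.≤ n → seq x n ℚ.+ ε ℚ.< seq y n)

private
  infixl 4 _<∙_

  -- Only the approximating sequences matter, so the proofs need not unfold.
  abstract
    _<∙_ : ∀ {p q r} → p ℚ.< q → q ≡ r → p ℚ.< r
    p<q <∙ q≡r = subst (_ ℚ.<_) q≡r p<q

    ½-positive : ∀ {ε} → 0ℚ ℚ.< ε → 0ℚ ℚ.< ½ ℚ.* ε
    ½-positive 0<ε = ℚ.*-monoʳ-<-pos ½ 0<ε

    ½-sum : ∀ ε → ½ ℚ.* ε ℚ.+ ½ ℚ.* ε ≡ ε
    ½-sum = solve 1 (λ e → con ½ :* e :+ con ½ :* e := e) refl
      where open +-*-Solver

    p≤∣p∣ : ∀ p → p ℚ.≤ ∣ p ∣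
    p≤∣p∣ p with ℚ.≤-total 0ℚ p
    ... | inj₁ 0≤p = ℚ.≤-reflexive (sym (ℚ.0≤p⇒∣p∣≡p 0≤p))
    ... | inj₂ p≤0 = ℚ.≤-trans p≤0 (ℚ.0≤∣p∣ p)

    ∣-∣-comm : ∀ p q → ∣ p ℚ.- q ∣ ≡ ∣ q ℚ.- p ∣
    ∣-∣-comm p q = trans (cong ∣_∣ lemma) (ℚ.∣-p∣≡∣p∣ (q ℚ.- p))
      where
      lemma : p ℚ.- q ≡ ℚ.- (q ℚ.- p)
      lemma = solve 2 (λ a b → a :- b := :- (b :- a)) refl p q
        where open +-*-Solver

    close⇒< : ∀ p q {ε} → ∣ p ℚ.- q ∣ ℚ.< ε → p ℚ.< q ℚ.+ ε
    close⇒< p q {ε} c =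
      subst (ℚ._< q ℚ.+ ε) lemma
        (ℚ.+-monoʳ-< q (ℚ.≤-<-trans (p≤∣p∣ (p ℚ.- q)) c))
      where
      lemma : q ℚ.+ (p ℚ.- q) ≡ p
      lemma = solve 2 (λ a b → b :+ (a :- b) := a) refl p q
        where open +-*-Solver

    close⇒> : ∀ p q {ε} → ∣ p ℚ.- q ∣ ℚ.< ε → q ℚ.< p ℚ.+ ε
    close⇒> p q {ε} c = close⇒< q p (subst (ℚ._< ε) (∣-∣-comm p q) c)

    <⇒diff< : ∀ {p q ε} → p ℚ.< q ℚ.+ ε → p ℚ.- q ℚ.< ε
    <⇒diff< {p} {q} {ε} p<q+ε = ℚ.+-monoˡ-< (ℚ.- q) p<q+ε <∙ lemma
      where
      lemma : q ℚ.+ ε ℚ.- q ≡ ε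
      lemma = solve 2 (λ b e → b :+ e :- b := e) refl q ε
        where open +-*-Solver

    <∧>⇒close : ∀ {p q ε} → p ℚ.< q ℚ.+ ε → q ℚ.< p ℚ.+ ε → ∣ p ℚ.- q ∣ ℚ.< ε
    <∧>⇒close {p} {q} {ε} p<q+ε q<p+ε with ℚ.∣p∣≡p∨∣p∣≡-p (p ℚ.- q)
    ... | inj₁ eq = subst (ℚ._< ε) (sym eq) (<⇒diff< p<q+ε)
    ... | inj₂ eq = subst (ℚ._< ε) (sym (trans eq lemma)) (<⇒diff< q<p+ε)
      where
      lemma : ℚ.- (p ℚ.- q) ≡ q ℚ.- p
      lemma = solve 2 (λ a b → :- (a :- b) := b :- a) refl p q
        where open +-*-Solver

    ⊔-mono-ε : ∀ p q r s {ε} → p ℚ.< r ℚ.+ ε → q ℚ.< s ℚ.+ ε →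
               p ℚ.⊔ q ℚ.< r ℚ.⊔ s ℚ.+ ε
    ⊔-mono-ε p q r s {ε} p< q< with ℚ.⊔-sel p q
    ... | inj₁ eq rewrite eq =
      ℚ.<-≤-trans p< (ℚ.+-monoˡ-≤ ε (ℚ.p≤p⊔q r s))
    ... | inj₂ eq rewrite eq =
      ℚ.<-≤-trans q< (ℚ.+-monoˡ-≤ ε (ℚ.p≤q⊔p r s))

    ⊓-mono-ε : ∀ p q r s {ε} → p ℚ.< r ℚ.+ ε → q ℚ.< s ℚ.+ ε →
               p ℚ.⊓ q ℚ.< r ℚ.⊓ s ℚ.+ ε
    ⊓-mono-ε p q r s {ε} p< q< with ℚ.⊓-sel r s
    ... | inj₁ eq rewrite eq = ℚ.≤-<-trans (ℚ.p⊓q≤p p q) p<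
    ... | inj₂ eq rewrite eq = ℚ.≤-<-trans (ℚ.p⊓q≤q p q) q<

    module _ {x y : ℕ → ℚ} (cx : Cauchy x) (cy : Cauchy y) where

      +-cauchy : Cauchy (λ n → x n ℚ.+ y n)
      +-cauchy ε 0<ε with cx _ (½-positive 0<ε) | cy _ (½-positive 0<ε)
      ... | M , hx | N , hy = M ℕ.⊔ N , λ {m} {n} m≥ n≥ →
        ℚ.≤-<-trans
          (subst (λ z → ∣ z ∣ ℚ.≤ ∣ x m ℚ.- x n ∣ ℚ.+ ∣ y m ℚ.- y n ∣)
            (lemma (x m) (y m) (x n) (y n))
            (ℚ.∣p+q∣≤∣p∣+∣q∣ (x m ℚ.- x n) (y m ℚ.- y n)))
          (ℚ.+-mono-< (hx (ℕ.m⊔n≤o⇒m≤o M N m≥) (ℕ.m⊔n≤o⇒m≤o M N n≥))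
                      (hy (ℕ.m⊔n≤o⇒n≤o M N m≥) (ℕ.m⊔n≤o⇒n≤o M N n≥))
           <∙ ½-sum ε)
        where
        lemma : ∀ a b c d → (a ℚ.- c) ℚ.+ (b ℚ.- d) ≡ (a ℚ.+ b) ℚ.- (c ℚ.+ d)
        lemma = solve 4
          (λ a b c d → (a :- c) :+ (b :- d) := (a :+ b) :- (c :+ d)) refl
          where open +-*-Solver

      lattice-cauchy : (_∙_ : ℚ → ℚ → ℚ) →
        (∀ p q r s {ε} → p ℚ.< r ℚ.+ ε → q ℚ.< s ℚ.+ ε → p ∙ q ℚ.< (r ∙ s) ℚ.+ ε) →
        Cauchy (λ n → x n ∙ y n)
      lattice-cauchy _∙_ mono ε 0<ε with cx ε 0<ε | cy ε 0<ε
      ... | M , hx | N , hy = M ℕ.⊔ N , λ {m} {n} m≥ n≥ →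
        let c = hx (ℕ.m⊔n≤o⇒m≤o M N m≥) (ℕ.m⊔n≤o⇒m≤o M N n≥)
            d = hy (ℕ.m⊔n≤o⇒n≤o M N m≥) (ℕ.m⊔n≤o⇒n≤o M N n≥)
        in <∧>⇒close
             (mono (x m) (y m) (x n) (y n)
               (close⇒< (x m) (x n) c) (close⇒< (y m) (y n) d))
             (mono (x n) (y n) (x m) (y m)
               (close⇒> (x m) (x n) c) (close⇒> (y m) (y n) d))

    bounded : ∀ {x} → Cauchy x →
      ∃[ B ] 0ℚ ℚ.< B × ∃[ N ] (∀ {n} → N ℕ.≤ n → ∣ x n ∣ ℚ.≤ B)
    bounded {x} cx with cx 1ℚ (ℚ.positive⁻¹ 1ℚ)
    ... | N , h = ∣ x N ∣ ℚ.+ 1ℚ , ℚ.+-mono-≤-< (ℚ.0≤∣p∣ (x N)) (ℚ.positive⁻¹ 1ℚ) , N ,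
      λ {n} n≥ → ℚ.≤-trans
        (subst (λ z → ∣ z ∣ ℚ.≤ ∣ x N ∣ ℚ.+ ∣ x n ℚ.- x N ∣) (lemma (x n) (x N))
          (ℚ.∣p+q∣≤∣p∣+∣q∣ (x N) (x n ℚ.- x N)))
        (ℚ.+-monoʳ-≤ ∣ x N ∣ (ℚ.<⇒≤ (h n≥ ℕ.≤-refl)))
      where
      lemma : ∀ a b → b ℚ.+ (a ℚ.- b) ≡ a
      lemma = solve 2 (λ a b → b :+ (a :- b) := a) refl
        where open +-*-Solver

    *-close : ∀ {ε B} → 0ℚ ℚ.< ε → 0ℚ ℚ.< B →
      ∃[ δ ] 0ℚ ℚ.< δ × (∀ p q → ∣ p ∣ ℚ.≤ B → ∣ q ∣ ℚ.< δ → ∣ p ℚ.* q ∣ ℚ.< ε)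
    *-close {ε} {B} 0<ε 0<B = δ , 0<δ , λ p q p≤B q<δ →
      subst (ℚ._< ε) (sym (ℚ.∣p*q∣≡∣p∣*∣q∣ p q))
        (ℚ.≤-<-trans
          (ℚ.*-monoʳ-≤-nonNeg ∣ q ∣ {{ℚ.nonNegative (ℚ.0≤∣p∣ q)}} p≤B)
          (ℚ.*-monoʳ-<-pos B q<δ <∙ Bδ≡ε))
      where
      instance
        B⁺ : ℚ.Positive B
        B⁺ = ℚ.positive 0<B
        B≢0 : ℚ.NonZero B
        B≢0 = ℚ.pos⇒nonZero B
        B⁻¹⁺ : ℚ.Positive (ℚ.1/ B)
        B⁻¹⁺ = ℚ.1/pos⇒pos B
      δ : ℚ
      δ = ℚ.1/ B ℚ.* ε
      0<δ : 0ℚ ℚ.< δ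
      0<δ = subst (ℚ._< δ) (ℚ.*-zeroʳ (ℚ.1/ B)) (ℚ.*-monoʳ-<-pos (ℚ.1/ B) 0<ε)
      Bδ≡ε : B ℚ.* δ ≡ ε
      Bδ≡ε = trans (sym (ℚ.*-assoc B (ℚ.1/ B) ε))
        (trans (cong (ℚ._* ε) (ℚ.*-inverseʳ B)) (ℚ.*-identityˡ ε))

    *-estimate : ∀ a b c d {ε} →
      ∣ a ℚ.* (b ℚ.- d) ∣ ℚ.< ½ ℚ.* ε → ∣ d ℚ.* (a ℚ.- c) ∣ ℚ.< ½ ℚ.* ε →
      ∣ a ℚ.* b ℚ.- c ℚ.* d ∣ ℚ.< ε
    *-estimate a b c d {ε} u v = ℚ.≤-<-trans
      (subst (λ z → ∣ z ∣ ℚ.≤ ∣ a ℚ.* (b ℚ.- d) ∣ ℚ.+ ∣ d ℚ.* (a ℚ.- c) ∣)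
        (lemma a b c d)
        (ℚ.∣p+q∣≤∣p∣+∣q∣ (a ℚ.* (b ℚ.- d)) (d ℚ.* (a ℚ.- c))))
      (ℚ.+-mono-< u v <∙ ½-sum ε)
      where
      lemma : ∀ a b c d →
        a ℚ.* (b ℚ.- d) ℚ.+ d ℚ.* (a ℚ.- c) ≡ a ℚ.* b ℚ.- c ℚ.* d
      lemma = solve 4
        (λ a b c d → a :* (b :- d) :+ d :* (a :- c) := a :* b :- c :* d) refl
        where open +-*-Solver

    *-cauchy : ∀ {x y} → Cauchy x → Cauchy y → Cauchy (λ n → x n ℚ.* y n)
    *-cauchy {x} {y} cx cy ε 0<ε =
      let B , 0<B , K , x≤B = bounded cx
          C , 0<C , L , y≤C = bounded cy
          δ , 0<δ , hB = *-close {½ ℚ.* ε} {B} (½-positive 0<ε) 0<B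
          γ , 0<γ , hC = *-close {½ ℚ.* ε} {C} (½-positive 0<ε) 0<C
          M , hy = cy δ 0<δ
          N , hx = cx γ 0<γ
      in (K ℕ.⊔ L) ℕ.⊔ (M ℕ.⊔ N) , λ {m} {n} m≥ n≥ →
        *-estimate (x m) (y m) (x n) (y n)
          (hB (x m) (y m ℚ.- y n) (x≤B (≥K K L M N m≥))
            (hy (≥M K L M N m≥) (≥M K L M N n≥)))
          (hC (y n) (x m ℚ.- x n) (y≤C (≥L K L M N n≥))
            (hx (≥N K L M N m≥) (≥N K L M N n≥)))
      where
      ≥K : ∀ K L M N {o} → (K ℕ.⊔ L) ℕ.⊔ (M ℕ.⊔ N) ℕ.≤ o → K ℕ.≤ o
      ≥K K L M N o≥ = ℕ.m⊔n≤o⇒m≤o K L (ℕ.m⊔n≤o⇒m≤o (K ℕ.⊔ L) (M ℕ.⊔ N) o≥)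
      ≥L : ∀ K L M N {o} → (K ℕ.⊔ L) ℕ.⊔ (M ℕ.⊔ N) ℕ.≤ o → L ℕ.≤ o
      ≥L K L M N o≥ = ℕ.m⊔n≤o⇒n≤o K L (ℕ.m⊔n≤o⇒m≤o (K ℕ.⊔ L) (M ℕ.⊔ N) o≥)
      ≥M : ∀ K L M N {o} → (K ℕ.⊔ L) ℕ.⊔ (M ℕ.⊔ N) ℕ.≤ o → M ℕ.≤ o
      ≥M K L M N o≥ = ℕ.m⊔n≤o⇒m≤o M N (ℕ.m⊔n≤o⇒n≤o (K ℕ.⊔ L) (M ℕ.⊔ N) o≥)
      ≥N : ∀ K L M N {o} → (K ℕ.⊔ L) ℕ.⊔ (M ℕ.⊔ N) ℕ.≤ o → N ℕ.≤ o
      ≥N K L M N o≥ = ℕ.m⊔n≤o⇒n≤o M N (ℕ.m⊔n≤o⇒n≤o (K ℕ.⊔ L) (M ℕ.⊔ N) o≥)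

    const-cauchy : ∀ q → Cauchy (λ _ → q)
    const-cauchy q ε 0<ε =
      0 , λ _ _ → subst (λ z → ∣ z ∣ ℚ.< ε) (sym (ℚ.+-inverseʳ q)) 0<ε

fromℚ : ℚ → ℝ
fromℚ q = mkℝ (λ _ → q) (const-cauchy q)

0ℝ : ℝ
0ℝ = fromℚ 0ℚ

infixl 6 _+_ _⊔_
infixl 7 _*_ _⊓_

_+_ _*_ _⊔_ _⊓_ : ℝ → ℝ → ℝ
x + y = mkℝ (λ n → seq x n ℚ.+ seq y n)
            (+-cauchy {seq x} {seq y} (cauchy x) (cauchy y))
x * y = mkℝ (λ n → seq x n ℚ.* seq y n)
            (*-cauchy {seq x} {seq y} (cauchy x) (cauchy y))
x ⊔ y = mkℝ (λ n → seq x n ℚ.⊔ seq y n)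
            (lattice-cauchy {seq x} {seq y} (cauchy x) (cauchy y) ℚ._⊔_ ⊔-mono-ε)
x ⊓ y = mkℝ (λ n → seq x n ℚ.⊓ seq y n)
            (lattice-cauchy {seq x} {seq y} (cauchy x) (cauchy y) ℚ._⊓_ ⊓-mono-ε)

infix 4 _≤sup_

-- ρ ≤ sup P, the supremum being taken among the extended reals: every real
-- below ρ is exceeded by an element of P.  In this form no real number
-- sup P is needed, whose existence could not be shown constructively.
_≤sup_ : ℝ → Pred ℝ 0ℓ → Set
ρ ≤sup P = ∀ r → r < ρ → ∃[ q ] P q × r < q

-- The natural number j stands for job j + 1.
record Realization : Set where
  field
    size      : ℕ → ℝ
    ordered   : ∀ j → size (suc j) ≤ size j
    nonneg    : ∀ j → 0ℝ ≤ size j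
    cutoff    : ℕ
    vanishing : ∀ j → cutoff ℕ.≤ j → size j ≈ 0ℝ

open Realization public

-- A partition of the jobs into m possibly empty sets, given by the machine
-- of each job: J i = { j ∣ S j ≡ i }.
Solution : ℕ → Set
Solution m = ℕ → Fin m

module _ {m : ℕ} where

  -- Jobs from the cutoff on have size zero and are left out of the sum.
  load : Realization → Solution m → Fin m → ℝ
  load p S i =
    foldr _+_ 0ℝ (map (size p) (filter (λ j → S j ≟ i) (upTo (cutoff p))))

  -- Loads are nonnegative, so starting from 0ℝ does not affect the maximum.
  completionTime : Realization → Solution m → ℝ
  completionTime p S = foldr _⊔_ 0ℝ (map (load p S) (allFin m))

IsOptimum : ℕ → Realization → ℝ → Set
IsOptimum m p ƛ =
  (Σ[ S ∈ Solution m ] completionTime p S ≈ ƛ) ×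
  ((S : Solution m) → ƛ ≤ completionTime p S)

TwoSolutionAlgorithm : ℕ → Set
TwoSolutionAlgorithm m = Solution m × Solution m

module _ {m : ℕ} where

  makespan : TwoSolutionAlgorithm m → Realization → ℝ
  makespan (S , T) p = completionTime p S ⊓ completionTime p T

  -- q is makespan / ƛ for some realization with optimum ƛ > 0.
  Ratio : TwoSolutionAlgorithm m → Pred ℝ 0ℓ
  Ratio A q = Σ[ p ∈ Realization ] Σ[ ƛ ∈ ℝ ]
    IsOptimum m p ƛ × 0ℝ < ƛ × q * ƛ ≈ makespan A p

  CompetitiveRatioAtLeast : TwoSolutionAlgorithm m → ℝ → Set
  CompetitiveRatioAtLeast A ρ = ρ ≤sup Ratio A

{-# OPTIONS --safe #-}

-- Scale to optimum 6.  Six realizations, each with total size 18 that splits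
-- into three machines of load 6, suffice: whatever two solutions do with the
-- first eight jobs, one of the six gives both of them a machine of load at
-- least 8.  The optimum 6 follows by averaging, and the case analysis over the
-- two assignments is a finite search that stops as soon as some realization
-- defeats both prefixes.
module Submission where

import Algebra.Properties.CommutativeSemigroup
import Algebra.Properties.Monoid.Mult
open import Data.Bool using (true; false; if_then_else_)
open import Data.Fin using (Fin; zero; suc)
open import Data.Fin.Properties using (_≟_; all?; any?)
open import Data.Integer using (+_)
open import Data.List using
  (List; []; _∷_; _++_; _∷ʳ_; applyDownFrom; filter; foldr; length; map; upTo)
open import Data.List.Properties using (filter-++; length-applyDownFrom; map-++; upTo-∷ʳ)
open import Data.List.Relation.Unary.Any as Any using (Any; here; there)
open import Data.List.Membership.Propositional using (_∈_)
open import Data.List.Membership.Propositional.Properties using (∈-allFin; ∈-map⁺)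
open import Data.Nat as ℕ using (ℕ; zero; suc; z≤n; s≤s; _≥_)
open import Data.Nat.ListAction using (sum)
open import Data.Nat.ListAction.Properties using (sum-++)
import Data.Nat.Properties as ℕ
open import Data.Product using (∃-syntax; _×_; _,_)
open import Data.Rational as ℚ using (ℚ; 0ℚ; 1ℚ; _/_; ∣_∣)
import Data.Rational.Properties as ℚ
open import Data.Sum using (_⊎_; inj₁; inj₂)
open import Data.Vec using (Vec; []; _∷_)
open import Data.Vec.Relation.Unary.Linked using (Linked; linked?; []; [-]; _∷_)
open import Defs
open import Function using (_∘_)
open import Relation.Binary.PropositionalEquality
  using (_≡_; refl; sym; trans; cong; cong₂; subst; module ≡-Reasoning)
open import Relation.Nullary using (Dec; yes; no; does; contradiction)
open import Relation.Nullary.Decidable using (True; toWitness; _×-dec_; _⊎-dec_)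

open Algebra.Properties.CommutativeSemigroup ℕ.+-commutativeSemigroup using (x∙yz≈y∙xz)
open Algebra.Properties.Monoid.Mult ℚ.+-0-monoid using (×-homo-+) renaming (_×_ to _·_)

-- Naturals as rationals and pointwise comparison of reals.

ι : ℕ → ℚ
ι n = n · 1ℚ

ι-nonneg : ∀ n → 0ℚ ℚ.≤ ι n
ι-nonneg zero    = ℚ.≤-refl
ι-nonneg (suc n) = ℚ.+-mono-≤ (ℚ.nonNegative⁻¹ 1ℚ) (ι-nonneg n)

ι-mono : ∀ {m n} → m ℕ.≤ n → ι m ℚ.≤ ι n
ι-mono {n = n} z≤n = ι-nonneg n
ι-mono (s≤s m≤n)   = ℚ.+-monoʳ-≤ 1ℚ (ι-mono m≤n)

pointwise-≈ : ∀ x y → (∀ n → seq x n ≡ seq y n) → x ≈ y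
pointwise-≈ x y x≡y ε 0<ε = 0 , λ {n} _ →
  subst (λ z → ∣ z ∣ ℚ.< ε)
    (sym (trans (cong (ℚ._- seq y n) (x≡y n)) (ℚ.+-inverseʳ (seq y n)))) 0<ε

pointwise-≤ : ∀ x y → (∀ n → seq x n ℚ.≤ seq y n) → x ≤ y
pointwise-≤ x y x≤y ε 0<ε = 0 , λ {n} _ →
  ℚ.≤-<-trans (x≤y n)
    (subst (ℚ._< seq y n ℚ.+ ε) (ℚ.+-identityʳ (seq y n)) (ℚ.+-monoʳ-< (seq y n) 0<ε))

-- Completion times and integer loads of prefixes.

∈⇒≤max : ∀ {x xs} → x ∈ xs → ∀ n → seq x n ℚ.≤ seq (foldr _⊔_ 0ℝ xs) n
∈⇒≤max {x} {_ ∷ xs} (here refl)  n = ℚ.p≤p⊔q (seq x n) (seq (foldr _⊔_ 0ℝ xs) n)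
∈⇒≤max {x} {y ∷ xs} (there x∈xs) n =
  ℚ.≤-trans (∈⇒≤max x∈xs n) (ℚ.p≤q⊔p (seq y n) (seq (foldr _⊔_ 0ℝ xs) n))

load≤completionTime : ∀ {m} p (S : Solution m) i n →
  seq (load p S i) n ℚ.≤ seq (completionTime p S) n
load≤completionTime p S i = ∈⇒≤max (∈-map⁺ (load p S) (∈-allFin i))

-- The assignment of the first k jobs is the list of their machines, the last
-- job first; job j is therefore assigned by the entry followed by j others.
prefixLoad : ∀ {m} → (ℕ → ℕ) → Fin m → List (Fin m) → ℕ
prefixLoad p i []      = 0
prefixLoad p i (x ∷ s) = (if does (x ≟ i) then p (length s) else 0) ℕ.+ prefixLoad p i s

prefixLoad-mono : ∀ {m} p i (S : Solution m) {k l} → k ℕ.≤ l →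
  prefixLoad p i (applyDownFrom S k) ℕ.≤ prefixLoad p i (applyDownFrom S l)
prefixLoad-mono p i S {l = zero}  z≤n = ℕ.≤-refl
prefixLoad-mono p i S {l = suc l} k≤1+l with ℕ.m≤n⇒m<n∨m≡n k≤1+l
... | inj₁ (s≤s k≤l) = ℕ.≤-trans (prefixLoad-mono p i S k≤l) (ℕ.m≤n+m _ _)
... | inj₂ refl      = ℕ.≤-refl

-- Links the recursion that suits the search to the sum that defines `load`. The newest job heads
-- `applyDownFrom S (suc k)` but ends `upTo (suc k)`, so the step splits `upTo` at its end.
prefixLoad-filter : ∀ {m} p i (S : Solution m) k →
  prefixLoad p i (applyDownFrom S k) ≡ sum (map p (filter (λ j → S j ≟ i) (upTo k)))
prefixLoad-filter p i S zero    = refl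
prefixLoad-filter p i S (suc k) = begin
  last (length (applyDownFrom S k)) ℕ.+ prefixLoad p i (applyDownFrom S k)
    ≡⟨ cong₂ ℕ._+_ (cong last (length-applyDownFrom S k)) (prefixLoad-filter p i S k) ⟩
  last k ℕ.+ weight (upTo k)
    ≡⟨ ℕ.+-comm (last k) _ ⟩
  weight (upTo k) ℕ.+ last k
    ≡⟨ cong (weight (upTo k) ℕ.+_) weight-[k] ⟨
  weight (upTo k) ℕ.+ weight (k ∷ [])
    ≡⟨ sum-++ (map p (filter P? (upTo k))) _ ⟨
  sum (map p (filter P? (upTo k)) ++ map p (filter P? (k ∷ [])))
    ≡⟨ cong sum (map-++ p (filter P? (upTo k)) _) ⟨
  sum (map p (filter P? (upTo k) ++ filter P? (k ∷ [])))
    ≡⟨ cong (sum ∘ map p) (filter-++ P? (upTo k) _) ⟨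
  weight (upTo k ∷ʳ k)
    ≡⟨ cong weight (upTo-∷ʳ k) ⟩
  weight (upTo (suc k))
    ∎
  where
  open ≡-Reasoning
  P? = λ j → S j ≟ i
  weight : List ℕ → ℕ
  weight js = sum (map p (filter P? js))
  last : ℕ → ℕ
  last l = if does (S k ≟ i) then p l else 0
  weight-[k] : weight (k ∷ []) ≡ last k
  weight-[k] with does (S k ≟ i)
  ... | true  = ℕ.+-identityʳ (p k)
  ... | false = refl

prefixLoad-total : ∀ p (s : List (Fin 3)) →
  prefixLoad p zero s ℕ.+ (prefixLoad p (suc zero) s ℕ.+ prefixLoad p (suc (suc zero)) s)
    ≡ sum (applyDownFrom p (length s))
prefixLoad-total p []      = refl
prefixLoad-total p (x ∷ s) =
  trans (split x (p (length s)) _ _ _) (cong (p (length s) ℕ.+_) (prefixLoad-total p s))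
  where
  split : ∀ (x : Fin 3) q a b c →
    (if does (x ≟ zero) then q else 0) ℕ.+ a ℕ.+
      ((if does (x ≟ suc zero) then q else 0) ℕ.+ b ℕ.+
       ((if does (x ≟ suc (suc zero)) then q else 0) ℕ.+ c))
      ≡ q ℕ.+ (a ℕ.+ (b ℕ.+ c))
  split zero             q a b c = ℕ.+-assoc q a (b ℕ.+ c)
  split (suc zero)       q a b c =
    trans (cong (a ℕ.+_) (ℕ.+-assoc q b c)) (x∙yz≈y∙xz a q (b ℕ.+ c))
  split (suc (suc zero)) q a b c =
    trans (cong (a ℕ.+_) (x∙yz≈y∙xz b q c)) (x∙yz≈y∙xz a q (b ℕ.+ c))

-- The six hard realizations.

at : ∀ {A : Set} {n} → A → Vec A n → ℕ → A
at d []       _       = d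
at d (x ∷ xs) zero    = x
at d (x ∷ xs) (suc j) = at d xs j

at-default : ∀ {A : Set} {n} (d : A) (xs : Vec A n) {j} → n ℕ.≤ j → at d xs j ≡ d
at-default d []       _         = refl
at-default d (x ∷ xs) (s≤s n≤j) = at-default d xs n≤j

at-antitone : ∀ {n} {xs : Vec ℕ n} → Linked _≥_ xs → ∀ j → at 0 xs (suc j) ℕ.≤ at 0 xs j
at-antitone                   []         j       = z≤n
at-antitone                   [-]        j       = z≤n
at-antitone {xs = _ ∷ _ ∷ _} (x≥y ∷ ys) zero    = x≥y
at-antitone {xs = _ ∷ _ ∷ _} (x≥y ∷ ys) (suc j) = at-antitone ys j

record Instance : Set where
  constructor ⟨_,_⟩
  field
    sizes    : Vec ℕ 8
    packing  : Vec (Fin 3) 8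
    {sorted} : True (linked? ℕ._≥?_ sizes)
    {packed} : True (all? λ i →
      prefixLoad (at 0 sizes) i (applyDownFrom (at zero packing) 8) ℕ.≟ 6)

  job : ℕ → ℕ
  -- The default 0 is the size of every job after the eighth.
  job = at 0 sizes

open Instance

-- The threshold 8 is 4/3 of the optimum 6.
Overloaded : Instance → List (Fin 3) → Set
Overloaded I s = ∃[ i ] 8 ℕ.≤ prefixLoad (job I) i s

-- In each of the first four, all sizes are multiples of 2 or all of 3, so a load above 6 is at
-- least 8 and only optimal packings survive; the last two tolerate load 7. No solution survives
-- both of the first two: one wants jobs 2 to 5 in pairs, the other jobs 3 to 5 together. The other
-- four deal with pairs of solutions that share these two out.
instances : List Instance
instances =
  ⟨ 6 ∷ 3 ∷ 3 ∷ 3 ∷ 3 ∷ 0 ∷ 0 ∷ 0 ∷ [] , a ∷ b ∷ b ∷ c ∷ c ∷ a ∷ a ∷ a ∷ [] ⟩ ∷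
  ⟨ 6 ∷ 6 ∷ 2 ∷ 2 ∷ 2 ∷ 0 ∷ 0 ∷ 0 ∷ [] , a ∷ b ∷ c ∷ c ∷ c ∷ a ∷ a ∷ a ∷ [] ⟩ ∷
  ⟨ 4 ∷ 4 ∷ 4 ∷ 2 ∷ 2 ∷ 2 ∷ 0 ∷ 0 ∷ [] , a ∷ b ∷ c ∷ a ∷ b ∷ c ∷ a ∷ a ∷ [] ⟩ ∷
  ⟨ 6 ∷ 2 ∷ 2 ∷ 2 ∷ 2 ∷ 2 ∷ 2 ∷ 0 ∷ [] , a ∷ b ∷ b ∷ b ∷ c ∷ c ∷ c ∷ a ∷ [] ⟩ ∷
  ⟨ 6 ∷ 6 ∷ 1 ∷ 1 ∷ 1 ∷ 1 ∷ 1 ∷ 1 ∷ [] , a ∷ b ∷ c ∷ c ∷ c ∷ c ∷ c ∷ c ∷ [] ⟩ ∷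
  ⟨ 3 ∷ 3 ∷ 3 ∷ 3 ∷ 3 ∷ 1 ∷ 1 ∷ 1 ∷ [] , a ∷ a ∷ b ∷ b ∷ c ∷ c ∷ c ∷ c ∷ [] ⟩ ∷
  []
  where
  a b c : Fin 3
  a = zero
  b = suc zero
  c = suc (suc zero)

-- Exhaustive search over pairs of prefixes.

Defeated : List (Fin 3) → List (Fin 3) → Set
-- The makespan is the smaller completion time, so one realization must overload both solutions.
Defeated s t = Any (λ I → Overloaded I s × Overloaded I t) instances

-- d bounds the number of further jobs needed.
Doomed : ℕ → List (Fin 3) → List (Fin 3) → Set
Doomed zero    s t = Defeated s t
Doomed (suc d) s t = Defeated s t ⊎ (∀ x y → Doomed d (x ∷ s) (y ∷ t))

overloaded? : ∀ I s → Dec (Overloaded I s)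
overloaded? I s = any? λ i → 8 ℕ.≤? prefixLoad (job I) i s

defeated? : ∀ s t → Dec (Defeated s t)
defeated? s t = Any.any? (λ I → overloaded? I s ×-dec overloaded? I t) instances

doomed? : ∀ d s t → Dec (Doomed d s t)
doomed? zero    s t = defeated? s t
doomed? (suc d) s t =
  defeated? s t ⊎-dec all? λ x → all? λ y → doomed? d (x ∷ s) (y ∷ t)

-- Proved by evaluating `doomed?`. Its disjunction tests defeat first, so defeated pairs are never
-- extended and far fewer than 9^8 pairs are visited.
doomed : Doomed 8 [] []
doomed = toWitness {a? = doomed? 8 [] []} _

defeated-later : ∀ {S T k l} → k ℕ.≤ l →
  Defeated (applyDownFrom S k) (applyDownFrom T k) →
  Defeated (applyDownFrom S l) (applyDownFrom T l)
defeated-later {S} {T} k≤l = Any.map λ {I} ((i , u) , (j , v)) →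
  (i , ℕ.≤-trans u (prefixLoad-mono (job I) i S k≤l)) ,
  (j , ℕ.≤-trans v (prefixLoad-mono (job I) j T k≤l))

-- Follows the branch of the search tree picked by `S` and `T`; a defeat met early persists because
-- loads only grow.
doomed⇒defeated : ∀ S T d k → Doomed d (applyDownFrom S k) (applyDownFrom T k) →
  Defeated (applyDownFrom S (d ℕ.+ k)) (applyDownFrom T (d ℕ.+ k))
doomed⇒defeated S T zero    k h        = h
doomed⇒defeated S T (suc d) k (inj₁ h) = defeated-later {S} {T} (ℕ.m≤n+m k (suc d)) h
doomed⇒defeated S T (suc d) k (inj₂ h) =
  subst (λ l → Defeated (applyDownFrom S l) (applyDownFrom T l)) (ℕ.+-suc d k)
    (doomed⇒defeated S T d (suc k) (h (S k) (T k)))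

-- From integer loads to real optima and ratios.

realize : Instance → Realization
realize I = record
  { size      = x
  ; ordered   = λ j → pointwise-≤ (x (suc j)) (x j) λ _ →
      ι-mono (at-antitone (toWitness (sorted I)) j)
  ; nonneg    = λ j → pointwise-≤ 0ℝ (x j) λ _ → ι-nonneg (job I j)
  ; cutoff    = 8
  ; vanishing = λ j 8≤j → pointwise-≈ (x j) 0ℝ λ _ → cong ι (at-default 0 (sizes I) 8≤j)
  }
  where
  x : ℕ → ℝ
  x j = fromℚ (ι (job I j))

module _ (I : Instance) where

  load-ι : ∀ (S : Solution 3) i n →
    seq (load (realize I) S i) n ≡ ι (prefixLoad (job I) i (applyDownFrom S 8))
  load-ι S i n = trans (sum-ι (filter (λ j → S j ≟ i) (upTo 8)))
    (cong ι (sym (prefixLoad-filter (job I) i S 8)))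
    where
    sum-ι : ∀ js →
      seq (foldr _+_ 0ℝ (map (size (realize I)) js)) n ≡ ι (sum (map (job I) js))
    sum-ι []       = refl
    sum-ι (j ∷ js) = trans (cong (ι (job I j) ℚ.+_) (sum-ι js))
      (sym (×-homo-+ 1ℚ (job I j) _))

  load⇒completionTime : ∀ {l} (S : Solution 3) i n →
    l ℕ.≤ prefixLoad (job I) i (applyDownFrom S 8) →
    ι l ℚ.≤ seq (completionTime (realize I) S) n
  load⇒completionTime S i n l≤ = ℚ.≤-trans (ι-mono l≤)
    (ℚ.≤-trans (ℚ.≤-reflexive (sym (load-ι S i n)))
      (load≤completionTime (realize I) S i n))

  packing-loads : ∀ i →
    prefixLoad (job I) i (applyDownFrom (at zero (packing I)) 8) ≡ 6
  packing-loads = toWitness (packed I)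

  total : sum (applyDownFrom (job I) 8) ≡ 18
  total = trans (sym (prefixLoad-total (job I) (applyDownFrom (at zero (packing I)) 8)))
    (cong₂ ℕ._+_ (packing-loads zero)
      (cong₂ ℕ._+_ (packing-loads (suc zero)) (packing-loads (suc (suc zero)))))

  -- Averaging over integers: three loads of at most 5 give at most 15, short of 18.
  some-load≥6 : (S : Solution 3) →
    ∃[ i ] 6 ℕ.≤ prefixLoad (job I) i (applyDownFrom S 8)
  some-load≥6 S with any? (λ i → 6 ℕ.≤? prefixLoad (job I) i (applyDownFrom S 8))
  ... | yes h = h
  ... | no ¬h = contradiction
    (subst (ℕ._≤ 15) (trans (prefixLoad-total (job I) (applyDownFrom S 8)) total)
      (ℕ.+-mono-≤ (≤5 zero) (ℕ.+-mono-≤ (≤5 (suc zero)) (≤5 (suc (suc zero))))))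
    (ℕ.<⇒≱ (ℕ.≤ᵇ⇒≤ 16 18 _))
    where
    ≤5 : ∀ i → prefixLoad (job I) i (applyDownFrom S 8) ℕ.≤ 5
    ≤5 i = ℕ.≤-pred (ℕ.≰⇒> (¬h ∘ (i ,_)))

  optimum : IsOptimum 3 (realize I) (fromℚ (ι 6))
  optimum =
    (P , pointwise-≈ (completionTime (realize I) P) (fromℚ (ι 6)) attained) ,
    λ S → pointwise-≤ (fromℚ (ι 6)) (completionTime (realize I) S) λ n →
      let i , 6≤ = some-load≥6 S in load⇒completionTime S i n 6≤
    where
    P : Solution 3
    P = at zero (packing I)
    attained : ∀ n → seq (completionTime (realize I) P) n ≡ ι 6
    -- Once each load is `ι 6`, the remaining maximum is closed and evaluates to `ι 6`.
    attained n = cong₂ ℚ._⊔_ (l zero)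
      (cong₂ ℚ._⊔_ (l (suc zero)) (cong (ℚ._⊔ 0ℚ) (l (suc (suc zero)))))
      where
      l : ∀ i → seq (load (realize I) P i) n ≡ ι 6
      l i = trans (load-ι P i n) (cong ι (packing-loads i))

  overloaded⇒ratio : ∀ S T →
    Overloaded I (applyDownFrom S 8) → Overloaded I (applyDownFrom T 8) →
    ∃[ q ] Ratio (S , T) q × (∀ n → + 4 / 3 ℚ.≤ seq q n)
  overloaded⇒ratio S T (i , u) (j , v) =
    fromℚ (+ 1 / 6) * M ,
    (realize I , fromℚ (ι 6) , optimum , 0<6 ,
      pointwise-≈ (fromℚ (+ 1 / 6) * M * fromℚ (ι 6)) M cancel) ,
    -- Both completion times are at least `ι 8`, and `(+ 1 / 6) ℚ.* ι 8` evaluates to 4/3.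
    λ n → ℚ.*-monoˡ-≤-nonNeg (+ 1 / 6)
      (ℚ.⊓-glb (load⇒completionTime S i n u) (load⇒completionTime T j n v))
    where
    M : ℝ
    M = makespan (S , T) (realize I)
    0<6 : 0ℝ < fromℚ (ι 6)
    0<6 = 1ℚ , ℚ.positive⁻¹ 1ℚ , 0 , λ _ → toWitness {a? = 1ℚ ℚ.<? ι 6} _
    cancel : ∀ n → (+ 1 / 6) ℚ.* seq M n ℚ.* ι 6 ≡ seq M n
    cancel n = trans (cong (ℚ._* ι 6) (ℚ.*-comm (+ 1 / 6) (seq M n)))
      (trans (ℚ.*-assoc (seq M n) (+ 1 / 6) (ι 6)) (ℚ.*-identityʳ (seq M n)))

proposition9 : (A : TwoSolutionAlgorithm 3) → CompetitiveRatioAtLeast A (fromℚ (+ 4 / 3))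
proposition9 (S , T) r (ε , 0<ε , N , r+ε<4/3) =
  let I , u , v         = Any.satisfied (doomed⇒defeated S T 8 0 doomed)
      q , ratio , 4/3≤q = overloaded⇒ratio I S T u v
  -- Every term of `q` is at least 4/3, so the margin and index witnessing `r` below 4/3 serve for
  -- `q` too.
  in q , ratio , ε , 0<ε , N , λ {n} N≤n → ℚ.<-≤-trans (r+ε<4/3 N≤n) (4/3≤q n)
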